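{- A configuration $\lambda$ is convex, i.e. $\lambda_i-\lambda_{i+1}\ge\lambda_{i+1}-\lambda_{i+2}\ge0$ for all $i\ge1$, if and only if there exists a well-behaved function $\sigma$ such that $\lambda$ is a stable configuration of $\sigma$-Bulgarian solitaire.
   Context: A configuration of $n$ cards is an integer partition $\lambda=(\lambda_1\ge\lambda_2\ge\cdots\ge\lambda_\ell>0)$ of a positive integer $n$ (pile sizes sorted in weakly decreasing order), extended by $\lambda_i=0$ for $i>\ell$. A function $\sigma$ from the positive integers to the nonnegative integers with $\sigma(h)\le h$ for all $h$ is well-behaved if $\sigma(1)=1$, $\sigma(h)$ is non-decreasing in $h$, and $\bar\sigma(h):=h-\sigma(h)$ is non-decreasing in $h$. In a move of $\sigma$-Bulgarian solitaire, $\sigma(h)$ cards are picked from each nonempty pile of size $h$, all picked cards together form one new pile, and the resulting piles are sorted in weakly decreasing order (empty piles being discarded). A configuration is stable if a move leaves it unchanged. -}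

module Defs where

open import Data.Integer as ℤ using (_⊖_)
open import Data.List using (List; []; _∷_; map; filter)
open import Data.Nat.ListAction using (sum)
open import Data.Nat.ListAction.Properties using (sum-↭)
open import Data.List.Relation.Binary.Permutation.Propositional.Properties using (All-resp-↭)
open import Data.List.Relation.Binary.Permutation.Propositional using (↭-sym)
open import Data.List.Relation.Unary.All using (All; []; _∷_)
open import Data.List.Relation.Unary.All.Properties using (all-filter)
open import Data.Nat using (ℕ; zero; suc; _+_; _∸_; _≤_; _<_)
open import Data.Nat.Properties
open import Algebra.Properties.CommutativeSemigroup +-commutativeSemigroup using (interchange)
open import Data.Product using (_×_)
open import Relation.Binary.Properties.DecTotalOrder ≤-decTotalOrder
  using (≥-totalOrder; ≥-decTotalOrder)
open import Relation.Binary.PropositionalEquality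

open import Data.List.Relation.Unary.Sorted.TotalOrder ≥-totalOrder using (Sorted)
open import Data.List.Sort ≥-decTotalOrder using (sort; sort-↭; sort-↗)

record Configuration (n : ℕ) : Set where
  field
    piles    : List ℕ
    sorted   : Sorted piles
    positive : All (0 <_) piles
    total    : sum piles ≡ n

open Configuration public

entry : List ℕ → ℕ → ℕ
entry []       _       = 0
entry (x ∷ _)  zero    = x
entry (_ ∷ xs) (suc i) = entry xs i

-- Indices are shifted by one: part c i is λᵢ₊₁ in the usual 1-based notation.
part : ∀ {n} → Configuration n → ℕ → ℕ
part c = entry (piles c)

-- The differences are integers: a ⊖ b is a - b, not truncated subtraction.
Convex : ∀ {n} → Configuration n → Set
Convex c = ∀ i →
    (part c i ⊖ part c (1 + i)) ℤ.≥ (part c (1 + i) ⊖ part c (2 + i))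
  × (part c (1 + i) ⊖ part c (2 + i)) ℤ.≥ ℤ.0ℤ

-- σ is only meaningful on positive integers. Its value at 0 is unconstrained
-- and never used, since every pile of a configuration is nonempty.
record Rule : Set where
  field
    σ   : ℕ → ℕ
    σ≤  : ∀ {h} → 1 ≤ h → σ h ≤ h

  σ̄ : ℕ → ℕ
  σ̄ h = h ∸ σ h

record WellBehaved (r : Rule) : Set where
  open Rule r
  field
    σ-one  : σ 1 ≡ 1
    σ-mono : ∀ {h k} → 1 ≤ h → h ≤ k → σ h ≤ σ k
    σ̄-mono : ∀ {h k} → 1 ≤ h → h ≤ k → σ̄ h ≤ σ̄ k

module _ (r : Rule) where
  open Rule r

  unsorted : List ℕ → List ℕ
  unsorted xs = sum (map σ xs) ∷ map σ̄ xs

  movePiles : List ℕ → List ℕ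
  movePiles xs = sort (filter (0 <?_) (unsorted xs))

  private
    sum-filter : ∀ xs → sum (filter (0 <?_) xs) ≡ sum xs
    sum-filter []           = refl
    sum-filter (zero  ∷ xs) = sum-filter xs
    sum-filter (suc x ∷ xs) = cong (suc x +_) (sum-filter xs)

    sum-split : ∀ {xs} → All (0 <_) xs → sum (map σ xs) + sum (map σ̄ xs) ≡ sum xs
    sum-split []                 = refl
    sum-split {x ∷ xs} (p ∷ ps) = begin
      (σ x + sum (map σ xs)) + (σ̄ x + sum (map σ̄ xs))
        ≡⟨ interchange (σ x) (sum (map σ xs)) (σ̄ x) (sum (map σ̄ xs)) ⟩
      (σ x + σ̄ x) + (sum (map σ xs) + sum (map σ̄ xs))
        ≡⟨ cong₂ _+_ (m+[n∸m]≡n (σ≤ p)) (sum-split ps) ⟩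
      x + sum xs ∎
      where open ≡-Reasoning

  move : ∀ {n} → Configuration n → Configuration n
  move c = record
    { piles    = movePiles xs
    ; sorted   = sort-↗ ys
    ; positive = All-resp-↭ (↭-sym (sort-↭ ys)) (all-filter (0 <?_) (unsorted xs))
    ; total    = trans (sum-↭ (sort-↭ ys))
                   (trans (sum-filter (unsorted xs))
                     (trans (sum-split (positive c)) (total c)))
    }
    where
      xs = piles c
      ys = filter (0 <?_) (unsorted xs)

  Stable : ∀ {n} → Configuration n → Set
  Stable c = piles (move c) ≡ piles c

{-# OPTIONS --safe #-}

-- Write λᵢ for the parts, with λᵢ = 0 beyond the last pile. Picking from a
-- nonempty pile shrinks it, so in a stable configuration the largest pile must
-- be the new one, and the other piles of the new configuration are the σ̄(λᵢ)
-- in order. Hence λ is stable iff σ̄(λᵢ) = λᵢ₊₁ for all i, that is,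
-- σ(λᵢ) = λᵢ - λᵢ₊₁, and convexity is the monotonicity of σ along λ.
-- Conversely, for convex λ let
--   σ̄(h) = maxⱼ min(λⱼ₊₁, max(0, h - (λⱼ - λⱼ₊₁))),
-- which is non-decreasing and 1-Lipschitz (so that σ is non-decreasing), and
-- takes the value λᵢ₊₁ at λᵢ.
module Submission where

open import Defs
open import Data.Nat using (ℕ; _<_)
open import Data.Product using (∃-syntax; _×_)
open import Function.Bundles using (_⇔_)

open import Data.Integer as ℤ using (_⊖_)
import Data.Integer.Properties as ℤₚ
open import Data.List using (List; []; _∷_; map; filter; length)
open import Data.List.Membership.Propositional using (_∈_)
open import Data.List.Membership.Propositional.Properties using (∈-filter⁻; ∈-map⁻)
open import Data.List.Properties using (filter-accept)
open import Data.List.Relation.Binary.Permutation.Propositional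
  using (_↭_; ↭-reflexive; ↭-trans; ↭⇒↭ₛ′)
open import Data.List.Relation.Binary.Permutation.Propositional.Properties using (drop-∷; ∈-resp-↭)
open import Data.List.Relation.Binary.Pointwise using (Pointwise-≡⇒≡)
open import Data.List.Relation.Unary.All as All using (All; []; _∷_)
open import Data.List.Relation.Unary.All.Properties using (all-filter)
import Data.List.Relation.Unary.AllPairs as AllPairs
open import Data.List.Relation.Unary.Any using (here; there)
open import Data.List.Relation.Unary.Linked as Linked using ([]; [-]; _∷_)
import Data.List.Relation.Unary.Sorted.TotalOrder.Properties as Sortedₚ
open import Data.Nat using (zero; suc; _+_; _∸_; _⊓_; _⊔_; _≤_; _≥_; z≤n; s≤s; s≤s⁻¹; z<s; _≤′_; ≤′-refl; ≤′-step)
open import Data.Nat.ListAction using (sum)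
open import Data.Nat.Properties
open import Data.Product using (_,_; proj₁)
open import Data.Sum using (inj₁; inj₂)
open import Function.Base using (_∘_)
open import Function.Bundles using (mk⇔)
open import Level using (Level)
open import Relation.Binary using (Rel; Reflexive; Transitive; DecTotalOrder)
open import Relation.Binary.Properties.DecTotalOrder ≤-decTotalOrder
  using (≥-totalOrder; ≥-decTotalOrder)
open import Relation.Binary.PropositionalEquality
open import Relation.Nullary using (contradiction)

open import Data.List.Relation.Unary.Sorted.TotalOrder ≥-totalOrder using (Sorted)
open import Data.List.Sort ≥-decTotalOrder using (sort; sort-↭; sort-↗)

-- Monotone and 1-Lipschitz sequences

private
  variable
    a ℓ : Level
    A   : Set a

module _ {_∼_ : Rel A ℓ} (∼-refl : Reflexive _∼_) (∼-trans : Transitive _∼_) (f : ℕ → A) where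

  steps⇒chain : (∀ i → f i ∼ f (suc i)) → ∀ {i j} → i ≤ j → f i ∼ f j
  steps⇒chain step = go ∘ ≤⇒≤′
    where
    go : ∀ {i j} → i ≤′ j → f i ∼ f j
    go ≤′-refl       = ∼-refl
    go (≤′-step i≤j) = ∼-trans (go i≤j) (step _)

NonIncreasing : (ℕ → ℕ) → Set
NonIncreasing f = ∀ i → f (suc i) ≤ f i

nonIncreasing : ∀ {f} → NonIncreasing f → ∀ {i j} → i ≤ j → f j ≤ f i
nonIncreasing = steps⇒chain {_∼_ = _≥_} ≤-refl (λ p q → ≤-trans q p) _

suc-∸-≤ : ∀ m n → suc m ∸ n ≤ suc (m ∸ n)
suc-∸-≤ m n = m≤n+o⇒m∸n≤o (suc m) n
  (≤-trans (s≤s (m≤n+m∸n m n)) (≤-reflexive (sym (+-suc n (m ∸ n)))))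

module _ {f : ℕ → ℕ} (lipschitz : ∀ h → f (suc h) ≤ suc (f h)) where

  complement-mono : ∀ {h k} → h ≤ k → h ∸ f h ≤ k ∸ f k
  complement-mono = steps⇒chain {_∼_ = _≤_} ≤-refl ≤-trans (λ h → h ∸ f h)
    -- The left side `suc h ∸ suc (f h)` reduces to `h ∸ f h`.
    (λ h → ∸-monoʳ-≤ (suc h) (lipschitz h))

-- Interpolation of a convex sequence

module Interpolation (e : ℕ → ℕ) where

  drop : ℕ → ℕ
  drop j = e j ∸ e (suc j)

  -- For non-increasing `e` this is the ramp that stays 0 up to `drop j`, then rises with slope 1
  -- and reaches its cap `e (suc j)` at `e j`.
  piece : ℕ → ℕ → ℕ
  piece j h = e (suc j) ⊓ (h ∸ drop j)

  -- The maximum over all `j` is cut to `j < N`; this loses nothing when `e` vanishes from `N` on,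
  -- because the later caps are 0.
  envelope : ℕ → ℕ → ℕ
  envelope zero    h = 0
  envelope (suc N) h = piece N h ⊔ envelope N h

  envelope-mono : ∀ N {h k} → h ≤ k → envelope N h ≤ envelope N k
  envelope-mono zero    h≤k = z≤n
  envelope-mono (suc N) h≤k =
    ⊔-mono-≤ (⊓-monoʳ-≤ (e (suc N)) (∸-monoˡ-≤ (drop N) h≤k)) (envelope-mono N h≤k)

  envelope-lipschitz : ∀ N h → envelope N (suc h) ≤ suc (envelope N h)
  envelope-lipschitz zero    h = z≤n
  envelope-lipschitz (suc N) h =
    ⊔-mono-≤ (⊓-mono-≤ (n≤1+n (e (suc N))) (suc-∸-≤ h (drop N))) (envelope-lipschitz N h)

  envelope-≤ : ∀ N {h b} → (∀ j → piece j h ≤ b) → envelope N h ≤ b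
  envelope-≤ zero    pieces≤b = z≤n
  envelope-≤ (suc N) pieces≤b = ⊔-lub (pieces≤b N) (envelope-≤ N pieces≤b)

  piece≤envelope : ∀ {N j} h → j < N → piece j h ≤ envelope N h
  piece≤envelope {suc N} {j} h j<1+N with m≤n⇒m<n∨m≡n (s≤s⁻¹ j<1+N)
  ... | inj₁ j<N  = ≤-trans (piece≤envelope h j<N) (m≤n⊔m (piece N h) (envelope N h))
  ... | inj₂ refl = m≤m⊔n (piece N h) (envelope N h)

  envelope≤id : ∀ N h → envelope N h ≤ h
  envelope≤id N h = envelope-≤ N (λ j → ≤-trans (m⊓n≤n (e (suc j)) _) (m∸n≤m h (drop j)))

  module _ (e↘ : NonIncreasing e) (drop↘ : NonIncreasing drop)
           {N : ℕ} (vanishes : ∀ {i} → N ≤ i → e i ≡ 0) where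

    e∸drop : ∀ i → e i ∸ drop i ≡ e (suc i)
    e∸drop i = m∸[m∸n]≡n (e↘ i)

    -- For `i ≤ j` the cap is small enough, as `e` does not increase. For `j ≤ i` the ramp subtracts
    -- at least `drop i`, as the drops do not increase.
    piece-at-e : ∀ i j → piece j (e i) ≤ e (suc i)
    piece-at-e i j with ≤-total i j
    ... | inj₁ i≤j = ≤-trans (m⊓n≤m (e (suc j)) _) (nonIncreasing e↘ (s≤s i≤j))
    ... | inj₂ j≤i = begin
      e (suc j) ⊓ (e i ∸ drop j) ≤⟨ m⊓n≤n (e (suc j)) _ ⟩
      e i ∸ drop j               ≤⟨ ∸-monoʳ-≤ (e i) (nonIncreasing drop↘ j≤i) ⟩
      e i ∸ drop i               ≡⟨ e∸drop i ⟩
      e (suc i)                  ∎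
      where open ≤-Reasoning

    e≤envelope : ∀ i → e (suc i) ≤ envelope N (e i)
    e≤envelope i with <-≤-connex i N
    ... | inj₁ i<N = begin
      e (suc i)     ≤⟨ ⊓-glb ≤-refl (≤-reflexive (sym (e∸drop i))) ⟩
      piece i (e i) ≤⟨ piece≤envelope (e i) i<N ⟩
      envelope N (e i) ∎
      where open ≤-Reasoning
    ... | inj₂ N≤i = ≤-trans (≤-reflexive (vanishes (m≤n⇒m≤1+n N≤i))) z≤n

    envelope-at-e : ∀ i → envelope N (e i) ≡ e (suc i)
    envelope-at-e i = ≤-antisym (envelope-≤ N (piece-at-e i)) (e≤envelope i)

    drop≡0⇒constant : ∀ {j} → drop j ≡ 0 → ∀ {k} → j ≤′ k → e j ≤ e k
    drop≡0⇒constant drop≡0 ≤′-refl            = ≤-refl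
    drop≡0⇒constant {j} drop≡0 (≤′-step {k} j≤k) = ≤-trans (drop≡0⇒constant drop≡0 j≤k)
      (m∸n≡0⇒m≤n (n≤0⇒n≡0 (≤-trans (nonIncreasing drop↘ (≤′⇒≤ j≤k)) (≤-reflexive drop≡0))))

    -- All drops after a zero drop are zero, so `e` stays constant from `j` on, and it vanishes at
    -- `j + N`.
    drop≡0⇒e≡0 : ∀ {j} → drop j ≡ 0 → e j ≡ 0
    drop≡0⇒e≡0 {j} drop≡0 = n≤0⇒n≡0 (≤-trans
      (drop≡0⇒constant drop≡0 (≤⇒≤′ (m≤m+n j N)))
      (≤-reflexive (vanishes (m≤n+m N j))))

    -- This yields `σ 1 ≡ 1`. A positive drop leaves nothing of 1, and a zero drop forces the cap to
    -- be 0.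
    piece-at-1 : ∀ j → piece j 1 ≤ 0
    piece-at-1 j with drop j in eq
    ... | zero  = ≤-trans (m⊓n≤m (e (suc j)) 1)
                    (≤-trans (e↘ j) (≤-reflexive (drop≡0⇒e≡0 eq)))
    ... | suc d = ≤-trans (m⊓n≤n (e (suc j)) (0 ∸ d)) (m∸n≤m 0 d)

    envelope-at-1 : envelope N 1 ≡ 0
    envelope-at-1 = n≤0⇒n≡0 (envelope-≤ N piece-at-1)

-- Piles as zero-padded sequences, and sorted lists

entry-vanishes : ∀ xs {i} → length xs ≤ i → entry xs i ≡ 0
entry-vanishes []       _         = refl
entry-vanishes (x ∷ xs) (s≤s l≤i) = entry-vanishes xs l≤i

entry-map : ∀ {f} → f 0 ≡ 0 → ∀ xs i → entry (map f xs) i ≡ f (entry xs i)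
entry-map f0 []       i       = sym f0
entry-map f0 (x ∷ xs) zero    = refl
entry-map f0 (x ∷ xs) (suc i) = entry-map f0 xs i

-- Positivity makes the first zero entry mark the length of the list.
entry-injective : ∀ {xs ys} → All (0 <_) xs → All (0 <_) ys → entry xs ≗ entry ys → xs ≡ ys
entry-injective []       []       eq = refl
entry-injective []       (y ∷ _)  eq = contradiction (eq 0) (<⇒≢ y)
entry-injective (x ∷ _)  []       eq = contradiction (sym (eq 0)) (<⇒≢ x)
entry-injective (_ ∷ xs) (_ ∷ ys) eq = cong₂ _∷_ (eq 0) (entry-injective xs ys (eq ∘ suc))

-- In a non-increasing list the zeros stand at the end, where `entry` returns 0 with or without
-- them.
entry-filter : ∀ ys → NonIncreasing (entry ys) → entry (filter (0 <?_) ys) ≗ entry ys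
entry-filter []           ys↘ i       = refl
entry-filter (suc y ∷ ys) ys↘ zero    = refl
entry-filter (suc y ∷ ys) ys↘ (suc i) = entry-filter ys (ys↘ ∘ suc) i
entry-filter (zero ∷ ys)  ys↘ i       = begin
  entry (filter (0 <?_) ys) i ≡⟨ entry-filter ys (ys↘ ∘ suc) i ⟩
  entry (zero ∷ ys) (suc i)   ≡⟨ all≡0 (suc i) ⟩
  0                           ≡⟨ all≡0 i ⟨
  entry (zero ∷ ys) i         ∎
  where
  open ≡-Reasoning
  all≡0 : ∀ j → entry (zero ∷ ys) j ≡ 0
  all≡0 j = n≤0⇒n≡0 (nonIncreasing ys↘ {j = j} z≤n)

Sorted⇒entry↘ : ∀ {xs} → Sorted xs → NonIncreasing (entry xs)
Sorted⇒entry↘ []        i       = z≤n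
Sorted⇒entry↘ [-]       i       = z≤n
Sorted⇒entry↘ (x≥y ∷ s) zero    = x≥y
Sorted⇒entry↘ (x≥y ∷ s) (suc i) = Sorted⇒entry↘ s i

∈-Sorted⇒≤head : ∀ {x xs y} → Sorted (x ∷ xs) → y ∈ x ∷ xs → y ≤ x
∈-Sorted⇒≤head s (here refl) = ≤-refl
∈-Sorted⇒≤head s (there y∈)  = All.lookup (AllPairs.head (Sortedₚ.Sorted⇒AllPairs ≥-totalOrder s)) y∈

Sorted-↭⇒≡ : ∀ {xs ys} → Sorted xs → Sorted ys → xs ↭ ys → xs ≡ ys
Sorted-↭⇒≡ xs↘ ys↘ xs↭ys = Pointwise-≡⇒≡ (Sortedₚ.↗↭↗⇒≋ ≥-totalOrder xs↘ ys↘
  (↭⇒↭ₛ′ (DecTotalOrder.Eq.isEquivalence ≥-decTotalOrder) xs↭ys))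

sort-Sorted : ∀ {xs} → Sorted xs → sort xs ≡ xs
sort-Sorted {xs} xs↘ = Sorted-↭⇒≡ (sort-↗ xs) xs↘ (sort-↭ xs)

-- Stability as a recurrence

module _ {r : Rule} (wb : WellBehaved r) where
  open Rule r
  open WellBehaved wb

  σ̄-zero : σ̄ 0 ≡ 0
  σ̄-zero = 0∸n≡0 (σ 0)

  σ̄-mono₀ : ∀ {h k} → h ≤ k → σ̄ h ≤ σ̄ k
  σ̄-mono₀ {zero}  _   = ≤-trans (≤-reflexive σ̄-zero) z≤n
  σ̄-mono₀ {suc h} h≤k = σ̄-mono z<s h≤k

  -- At least one card is picked from the pile, since `σ h` is at least `σ 1`.
  σ̄-< : ∀ {h} → 0 < h → σ̄ h < h
  σ̄-< {h@(suc _)} 0<h = ∸-monoʳ-< {h} {o = 0} (subst (_≤ σ h) σ-one (σ-mono z<s 0<h)) (σ≤ 0<h)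

  -- `h ∸ σ̄ h` agrees with `σ h` for positive `h` and is 0 at 0, whatever `σ 0` is, so that
  -- monotonicity extends to the zero entries.
  σ∸-mono : ∀ {h k} → h ≤ k → h ∸ σ̄ h ≤ k ∸ σ̄ k
  σ∸-mono {zero}  {k} _   = ≤-trans (m∸n≤m 0 (σ̄ 0)) z≤n
  σ∸-mono {suc h} {k} h≤k = begin
    suc h ∸ σ̄ (suc h) ≡⟨ m∸[m∸n]≡n (σ≤ z<s) ⟩
    σ (suc h)         ≤⟨ σ-mono z<s h≤k ⟩
    σ k               ≡⟨ m∸[m∸n]≡n (σ≤ (≤-trans z<s h≤k)) ⟨
    k ∸ σ̄ k           ∎
    where open ≤-Reasoning

  -- At the last pile this says that all of its cards are picked.
  Recurrence : List ℕ → Set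
  Recurrence xs = ∀ i → σ̄ (entry xs i) ≡ entry xs (suc i)

  -- The sum telescopes, each `σ x` being the difference of consecutive entries.
  sum-σ : ∀ {xs} → All (0 <_) xs → Recurrence xs → sum (map σ xs) ≡ entry xs 0
  sum-σ []                       rec = refl
  sum-σ {x ∷ xs} (0<x ∷ xs-pos) rec = begin
    σ x + sum (map σ xs) ≡⟨ cong (σ x +_) (sum-σ xs-pos (rec ∘ suc)) ⟩
    σ x + entry xs 0     ≡⟨ cong (σ x +_) (rec 0) ⟨
    σ x + σ̄ x            ≡⟨ m+[n∸m]≡n (σ≤ 0<x) ⟩
    x                    ∎
    where open ≡-Reasoning

  -- Even before sorting, the new piles have the entries of the old ones, so filtering removes only
  -- trailing zeros and sorting changes nothing.
  Recurrence⇒Stable : ∀ {n} (c : Configuration n) → Recurrence (piles c) → Stable r c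
  Recurrence⇒Stable c rec = begin
    sort (filter (0 <?_) ys) ≡⟨ cong sort filter≡xs ⟩
    sort xs                  ≡⟨ sort-Sorted (sorted c) ⟩
    xs                       ∎
    where
    open ≡-Reasoning
    xs = piles c
    ys = unsorted r xs

    entry-ys : entry ys ≗ entry xs
    entry-ys zero    = sum-σ (positive c) rec
    entry-ys (suc i) = trans (entry-map σ̄-zero xs i) (rec i)

    ys↘ : NonIncreasing (entry ys)
    ys↘ i = subst₂ _≤_ (sym (entry-ys (suc i))) (sym (entry-ys i)) (Sorted⇒entry↘ (sorted c) i)

    filter≡xs : filter (0 <?_) ys ≡ xs
    filter≡xs = entry-injective (all-filter (0 <?_) ys) (positive c)
      (λ i → trans (entry-filter ys ys↘ i) (entry-ys i))

  ↭⇒Recurrence : ∀ {xs} → Sorted xs → All (0 <_) xs →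
                 xs ↭ filter (0 <?_) (unsorted r xs) → Recurrence xs
  ↭⇒Recurrence {[]}     _  _   _  i = σ̄-zero
  ↭⇒Recurrence {x ∷ xs} s↘ pos@(0<x ∷ _) p i = begin
    σ̄ (entry (x ∷ xs) i)        ≡⟨ entry-map σ̄-zero (x ∷ xs) i ⟨
    entry ys i                  ≡⟨ entry-filter ys (Sorted⇒entry↘ ys↘) i ⟨
    entry (filter (0 <?_) ys) i ≡⟨ cong (λ zs → entry zs i) xs≡ ⟨
    entry xs i                  ∎
    where
    open ≡-Reasoning
    ys = map σ̄ (x ∷ xs)

    ys↘ : Sorted ys
    ys↘ = Sortedₚ.map⁺ ≥-totalOrder ≥-totalOrder σ̄-mono₀ s↘

    -- The largest pile `x` occurs after the move, but not as some `σ̄ y`, since `σ̄ y < y ≤ x`;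
    -- hence it is the new pile.
    S≡x : sum (map σ (x ∷ xs)) ≡ x
    S≡x with proj₁ (∈-filter⁻ (0 <?_) {xs = unsorted r (x ∷ xs)} (∈-resp-↭ p (here refl)))
    ... | here x≡S = sym x≡S
    ... | there x∈ys with y , y∈ , x≡σ̄y ← ∈-map⁻ σ̄ x∈ys =
      contradiction x≡σ̄y (>⇒≢ (<-≤-trans (σ̄-< (All.lookup pos y∈)) (∈-Sorted⇒≤head s↘ y∈)))

    -- Cancelling `x` on both sides leaves two sorted lists that are permutations of each other,
    -- hence equal.
    xs↭ : xs ↭ filter (0 <?_) ys
    xs↭ = drop-∷ (↭-trans p (↭-reflexive (trans
      (cong (λ S → filter (0 <?_) (S ∷ ys)) S≡x) (filter-accept (0 <?_) 0<x))))

    xs≡ : xs ≡ filter (0 <?_) ys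
    xs≡ = Sorted-↭⇒≡ (Linked.tail s↘) (Sortedₚ.filter⁺ ≥-totalOrder (0 <?_) ys↘) xs↭

  Stable⇒Recurrence : ∀ {n} (c : Configuration n) → Stable r c → Recurrence (piles c)
  Stable⇒Recurrence c stable = ↭⇒Recurrence (sorted c) (positive c)
    (↭-trans (↭-reflexive (sym stable)) (sort-↭ _))

-- Convexity and stability

module _ {n} (c : Configuration n) where
  open Interpolation (part c)

  part↘ : NonIncreasing (part c)
  part↘ = Sorted⇒entry↘ (sorted c)

  -- Parts do not increase, so the truncation in `drop` loses nothing.
  ⊖≡drop : ∀ i → part c i ⊖ part c (suc i) ≡ ℤ.+ drop i
  ⊖≡drop i = ℤₚ.⊖-≥ (part↘ i)

  Convex⇒drop↘ : Convex c → NonIncreasing drop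
  Convex⇒drop↘ convex i =
    ℤₚ.drop‿+≤+ (subst₂ ℤ._≤_ (⊖≡drop (suc i)) (⊖≡drop i) (proj₁ (convex i)))

  drop↘⇒Convex : NonIncreasing drop → Convex c
  drop↘⇒Convex drop↘ i =
      subst₂ ℤ._≤_ (sym (⊖≡drop (suc i))) (sym (⊖≡drop i)) (ℤ.+≤+ (drop↘ i))
    , subst (ℤ.0ℤ ℤ.≤_) (sym (⊖≡drop (suc i))) (ℤ.+≤+ z≤n)

  Stable⇒Convex : ∀ {r} → WellBehaved r → Stable r c → Convex c
  Stable⇒Convex {r} wb stable = drop↘⇒Convex λ i → begin
    part c (suc i) ∸ part c (2 + i)      ≡⟨ cong (part c (suc i) ∸_) (rec (suc i)) ⟨
    part c (suc i) ∸ σ̄ (part c (suc i)) ≤⟨ σ∸-mono wb (part↘ i) ⟩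
    part c i ∸ σ̄ (part c i)             ≡⟨ cong (part c i ∸_) (rec i) ⟩
    part c i ∸ part c (suc i)            ∎
    where
    open ≤-Reasoning
    open Rule r
    rec = Stable⇒Recurrence wb c stable

  Convex⇒Stable : Convex c → ∃[ r ] (WellBehaved r × Stable r c)
  Convex⇒Stable convex = rule , wellBehaved , Recurrence⇒Stable wellBehaved c recurrence
    where
    N = length (piles c)
    drop↘ = Convex⇒drop↘ convex
    vanishes = λ {i} → entry-vanishes (piles c) {i}

    rule : Rule
    rule = record { σ = λ h → h ∸ envelope N h ; σ≤ = λ {h} _ → m∸n≤m h (envelope N h) }
    open Rule rule

    -- `σ̄` is a double complement of the envelope, which gives the envelope back because it lies
    -- below the identity.
    σ̄≡envelope : ∀ h → σ̄ h ≡ envelope N h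
    σ̄≡envelope h = m∸[m∸n]≡n (envelope≤id N h)

    wellBehaved : WellBehaved rule
    wellBehaved = record
      { σ-one  = cong (1 ∸_) (envelope-at-1 part↘ drop↘ vanishes)
      ; σ-mono = λ _ → complement-mono (envelope-lipschitz N)
      ; σ̄-mono = λ {h} {k} _ h≤k →
          subst₂ _≤_ (sym (σ̄≡envelope h)) (sym (σ̄≡envelope k)) (envelope-mono N h≤k)
      }

    recurrence : Recurrence wellBehaved (piles c)
    recurrence i = trans (σ̄≡envelope (part c i)) (envelope-at-e part↘ drop↘ vanishes i)

lemma2 : ∀ (n : ℕ) → 0 < n → (c : Configuration n) →
    Convex c ⇔ (∃[ r ] (WellBehaved r × Stable r c))
lemma2 n _ c = mk⇔ (Convex⇒Stable c) (λ (_ , wb , stable) → Stable⇒Convex c wb stable)
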